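{- Let $\phi$ be any formula of the 3-SAT problem with $t$ clauses and $k$ Boolean variables. Put $m = k+3t$ and $n = k+2t$. Then there exist a matrix $B \in \mathbb{Z}^{m\times n}$ of rank $n$ and a vector $b \in \mathbb{Z}^m$, with all entries of $B$ and $b$ bounded by $2$ in absolute value, such that $\phi$ is satisfiable if and only if $d(b, L(B)) \le \sqrt{n}$.
   Context: A Boolean variable takes values in $\{0,1\}$ ($0$ is False, $1$ is True). A literal is a Boolean variable $x$ or its negation $\neg x = 1-x$. A clause is a disjunction (OR) of literals, and an $\ell$-clause is a disjunction of $\ell$ literals. A formula of the 3-SAT problem with $t$ clauses in $k$ Boolean variables $x_1,\dots,x_k$ is a conjunction (AND) of $t$ clauses in these variables, each of which is an $\ell$-clause with $1 \le \ell \le 3$. It is satisfiable if some assignment $x_1,\dots,x_k \in \{0,1\}$ makes the formula true. For $B \in \mathbb{R}^{m\times n}$, the lattice generated by $B$ is $L(B) = \{Bx : x \in \mathbb{Z}^n\} \subset \mathbb{R}^m$. For $b, v \in \mathbb{R}^m$, $d(b,v) = \|b-v\|$ is the Euclidean distance, and $d(b, L(B)) = \inf_{v \in L(B)} d(b,v)$. -}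

module Defs where

open import Data.Bool.Base using (Bool; true; false; not; _∧_; _∨_)
open import Data.Fin.Base using (Fin)
open import Data.Integer.Base as ℤ using (ℤ)
import Data.Integer.Properties as ℤ
open import Data.Nat.Base as ℕ using (ℕ)
open import Data.Product.Base using (∃; _×_)
open import Data.Rational.Base as ℚ using (ℚ; 0ℚ; _/_)
import Data.Rational.Properties as ℚ
open import Data.Vec.Base as Vec using (Vec)
open import Data.Vec.Functional using (Vector)
open import Relation.Binary.PropositionalEquality using (_≡_)
open import Relation.Unary using (Pred)
open import Level using (0ℓ)

import Algebra.Properties.CommutativeMonoid.Sum ℤ.+-0-commutativeMonoid as Sumℤ
import Algebra.Properties.CommutativeMonoid.Sum ℚ.+-0-commutativeMonoid as Sumℚ

data Literal (k : ℕ) : Set where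
  pos neg : Fin k → Literal k

record Clause (k : ℕ) : Set where
  constructor clause
  field
    width    : ℕ
    1≤width  : 1 ℕ.≤ width
    width≤3  : width ℕ.≤ 3
    literals : Vec (Literal k) width

open Clause public

Formula : (k t : ℕ) → Set
Formula k t = Vec (Clause k) t

Assignment : ℕ → Set
Assignment k = Vec Bool k

evalLiteral : ∀ {k} → Assignment k → Literal k → Bool
evalLiteral a (pos i) = Vec.lookup a i
evalLiteral a (neg i) = not (Vec.lookup a i)

evalClause : ∀ {k} → Assignment k → Clause k → Bool
evalClause a c = Vec.foldr′ _∨_ false (Vec.map (evalLiteral a) (literals c))

evalFormula : ∀ {k t} → Assignment k → Formula k t → Bool
evalFormula a φ = Vec.foldr′ _∧_ true (Vec.map (evalClause a) φ)

Satisfiable : ∀ {k t} → Formula k t → Set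
Satisfiable φ = ∃ λ a → evalFormula a φ ≡ true

Matrix : (m n : ℕ) → Set
Matrix m n = Fin m → Fin n → ℤ

_·_ : ∀ {m n} → Matrix m n → Vector ℤ n → Vector ℤ m
(B · x) i = Sumℤ.sum (λ j → B i j ℤ.* x j)

ℤ→ℚ : ℤ → ℚ
ℤ→ℚ z = z / 1

-- Linear independence over ℚ of the family of columns j ↦ c j of B.  A family
-- that repeats a column is never independent.
ColumnsIndependent : ∀ {m n s} → Matrix m n → (Fin s → Fin n) → Set
ColumnsIndependent {s = s} B c =
  ∀ (q : Vector ℚ s) →
  (∀ i → Sumℚ.sum (λ j → ℤ→ℚ (B i (c j)) ℚ.* q j) ≡ 0ℚ) →
  ∀ j → q j ≡ 0ℚ

HasRank : ∀ {m n} → Matrix m n → ℕ → Set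
HasRank {n = n} B r =
  (∃ λ (c : Fin r → Fin n) → ColumnsIndependent B c) ×
  (∀ s (c : Fin s → Fin n) → ColumnsIndependent B c → s ℕ.≤ r)

-- A real number x is represented by the set { q ∈ ℚ ∣ x < q }.  Square roots
-- and infima of sets, which are all that is needed for distances, are
-- computed on this representation without any choice or decidability.
ℝᵘ : Set₁
ℝᵘ = Pred ℚ 0ℓ

-- x ≤ y iff every rational strictly above y is strictly above x.
infix 4 _≤ᵘ_
_≤ᵘ_ : ℝᵘ → ℝᵘ → Set
x ≤ᵘ y = ∀ q → y q → x q

-- For a ≥ 0:  √a < q  iff  0 < q and a < q².
√ : ℚ → ℝᵘ
√ a q = (0ℚ ℚ.< q) × (a ℚ.< q ℚ.* q)

-- inf { f v ∣ v ∈ P } < q  iff  f v < q for some v ∈ P.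
inf : {A : Set} → Pred A 0ℓ → (A → ℝᵘ) → ℝᵘ
inf P f q = ∃ λ v → P v × f v q

L : ∀ {m n} → Matrix m n → Pred (Vector ℤ m) 0ℓ
L B v = ∃ λ x → ∀ i → v i ≡ (B · x) i

dist : ∀ {m} → Vector ℤ m → Vector ℤ m → ℝᵘ
dist b v = √ (ℤ→ℚ (Sumℤ.sum (λ i → (b i ℤ.- v i) ℤ.* (b i ℤ.- v i))))

distToSet : ∀ {m} → Vector ℤ m → Pred (Vector ℤ m) 0ℓ → ℝᵘ
distToSet b P = inf P (dist b)

{-# OPTIONS --safe #-}
module Submission where

-- Take B to be 2I stacked on a matrix A with one row per clause, and b to be (1,…,1) stacked on a
-- vector β.  Each of the n rows of 2I contributes (1 - 2xⱼ)² ≥ 1 to ‖b - Bx‖², with equality iff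
-- xⱼ ∈ {0,1}, so ‖b - Bx‖² ≤ n holds iff x is a 0/1 solution of Ax = β.  Every clause gets two slack
-- variables u, v, and its row of Ax = β says that exactly three of its distinct literals together
-- with ¬u, ¬v are true; since a clause has at most three literals, u and v can be chosen so iff at
-- least one of its literals is true.  Dropping repeated literals keeps the entries of A small.

open import Defs
open import Algebra.Bundles using (CommutativeMonoid; AbelianGroup)
import Algebra.Properties.CommutativeMonoid.Sum as Sum
import Algebra.Properties.Group as Group
open import Data.Bool.Base using (Bool; true; false; not; if_then_else_; _∨_)
open import Data.Fin.Base using (Fin; zero; suc; _↑ˡ_; _↑ʳ_; splitAt; combine; remQuot)
import Data.Fin.Properties as Fin
open import Data.Integer.Base as ℤ using (ℤ; +_; -[1+_]; ∣_∣; 0ℤ; 1ℤ; -1ℤ; _⊖_)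
import Data.Integer.Properties as ℤ
import Data.Integer.Tactic.RingSolver as ℤ
open import Data.List.Base as List using (List; []; _∷_; length; deduplicate)
open import Data.List.Properties using (length-deduplicate)
open import Data.List.Relation.Unary.All using (All; []; _∷_)
open import Data.List.Relation.Unary.AllPairs.Core using ([]; _∷_)
open import Data.List.Relation.Unary.Any using (Any; here; there)
open import Data.List.Relation.Unary.Any.Properties using (deduplicate⁺; deduplicate⁻)
open import Data.List.Relation.Unary.Unique.DecPropositional.Properties using (deduplicate-!)
open import Data.List.Relation.Unary.Unique.Propositional using (Unique)
open import Data.List.Relation.Unary.Unique.Propositional.Properties using (map⁺)
open import Data.Nat.Base as ℕ using (ℕ; zero; suc; _+_; _*_; _≤_; _<_; _<ᵇ_; z≤n; s≤s)
import Data.Nat.Properties as ℕ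
import Data.Nat.Tactic.RingSolver as ℕ
open import Data.Product.Base using (Σ; ∃; _×_; _,_; uncurry)
open import Data.Rational.Base as ℚ using (ℚ; 0ℚ; 1ℚ; ½; toℚᵘ; fromℚᵘ)
import Data.Rational.Properties as ℚ
open import Data.Rational.Unnormalised.Base as ℚᵘ using (mkℚᵘ)
import Data.Rational.Unnormalised.Properties as ℚᵘ
open import Data.Sum.Base using (inj₁; inj₂; [_,_]′)
open import Data.Vec.Base as Vec using (Vec; []; _∷_; lookup; tabulate; toList)
open import Data.Vec.Functional using (Vector; replicate; updateAt; _++_)
open import Data.Vec.Functional.Properties
  using (updateAt-updates; updateAt-minimal; lookup-++ˡ; lookup-++ʳ)
open import Data.Vec.Properties using (lookup∘tabulate; length-toList)
open import Function.Base using (_∘_; const; id)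
open import Function.Bundles using (_⇔_; mk⇔; Equivalence)
open import Function.Construct.Composition using (_⇔-∘_)
open import Function.Construct.Symmetry using (⇔-sym)
open import Relation.Binary.Definitions using (DecidableEquality)
open import Relation.Binary.PropositionalEquality
open import Relation.Nullary using (yes; no; contradiction; does)
import Relation.Nullary.Decidable as Dec

open Group (AbelianGroup.group ℤ.+-0-abelianGroup) using (∙-cancelˡ; ∙-cancelʳ)
open Sum ℤ.+-0-commutativeMonoid using (sum; sum-cong-≗; ∑-distrib-+; sum-replicate-zero)
module Sumℚ = Sum ℚ.+-0-commutativeMonoid

-- Finite sums: a single nonzero term, termwise comparison, concatenation.

module _ {c ℓ} (M : CommutativeMonoid c ℓ) where
  open CommutativeMonoid M renaming (Carrier to C; refl to ≈-refl; trans to ≈-trans; sym to ≈-sym)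
  private module S = Sum M

  -- Stated over any commutative monoid because matrix-vector products use it over ℤ and linear
  -- independence uses it over ℚ.
  sum-supported-at : ∀ {n} i (f : Vector C n) → (∀ j → j ≢ i → f j ≈ ε) → S.sum f ≈ f i
  sum-supported-at {suc n} zero f z =
    ≈-trans (∙-congˡ (≈-trans (S.sum-cong-≋ λ j → z (suc j) λ ()) (S.sum-replicate-zero n)))
            (identityʳ _)
  sum-supported-at (suc i) f z =
    ≈-trans (∙-cong (z zero λ ())
                    (sum-supported-at i (f ∘ suc) λ j j≢i → z (suc j) (j≢i ∘ Fin.suc-injective)))
            (identityˡ _)

spike : ∀ {n} {A : Set} → A → A → Fin n → Vector A n
spike {n} z a i = updateAt (replicate n z) i (const a)

spike-at : ∀ {n} {A : Set} (z a : A) (i : Fin n) → spike z a i i ≡ a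
spike-at {n} z a i = updateAt-updates i (replicate n z)

spike-off : ∀ {n} {A : Set} (z a : A) {i j : Fin n} → j ≢ i → spike z a i j ≡ z
spike-off {n} z a {i} {j} j≢i = updateAt-minimal j i (replicate n z) j≢i

sum-spike-* : ∀ {n} a i (x : Vector ℤ n) → sum (λ j → spike 0ℤ a i j ℤ.* x j) ≡ a ℤ.* x i
sum-spike-* a i x =
  trans (sum-supported-at ℤ.+-0-commutativeMonoid i _
          λ j j≢i → trans (cong (ℤ._* x j) (spike-off 0ℤ a j≢i)) (ℤ.*-zeroˡ (x j)))
        (cong (ℤ._* x i) (spike-at 0ℤ a i))

sumℚ-*-spike : ∀ {n} a i (w : Vector ℚ n) → Sumℚ.sum (λ j → w j ℚ.* spike 0ℚ a i j) ≡ w i ℚ.* a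
sumℚ-*-spike a i w =
  trans (sum-supported-at ℚ.+-0-commutativeMonoid i _
          λ j j≢i → trans (cong (w j ℚ.*_) (spike-off 0ℚ a j≢i)) (ℚ.*-zeroʳ (w j)))
        (cong (w i ℚ.*_) (spike-at 0ℚ a i))

sum-mono-≤ : ∀ {n} {f g : Vector ℤ n} → (∀ i → f i ℤ.≤ g i) → sum f ℤ.≤ sum g
sum-mono-≤ {zero}  f≤g = ℤ.≤-refl
sum-mono-≤ {suc n} f≤g = ℤ.+-mono-≤ (f≤g zero) (sum-mono-≤ (f≤g ∘ suc))

-- One strict inequality among the terms would make the totals strictly ordered. This is what turns
-- a single bound on a squared norm into one equation per row.
sum-tight : ∀ {n} {f g : Vector ℤ n} → (∀ i → f i ℤ.≤ g i) → sum g ℤ.≤ sum f → ∀ i → f i ≡ g i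
sum-tight {f = f} {g} f≤g Σg≤Σf zero with f zero ℤ.≟ g zero
... | yes f₀≡g₀ = f₀≡g₀
... | no  f₀≢g₀ = contradiction Σg≤Σf
  (ℤ.<⇒≱ (ℤ.+-mono-<-≤ (ℤ.≤∧≢⇒< (f≤g zero) f₀≢g₀) (sum-mono-≤ (f≤g ∘ suc))))
sum-tight {f = f} {g} f≤g Σg≤Σf (suc i) = sum-tight (f≤g ∘ suc) tail≤ i
  where
  tail≤ : sum (g ∘ suc) ℤ.≤ sum (f ∘ suc)
  tail≤ = ℤ.≮⇒≥ λ lt → contradiction Σg≤Σf (ℤ.<⇒≱ (ℤ.+-mono-≤-< (f≤g zero) lt))

sum-replicate-1 : ∀ n → sum (replicate n 1ℤ) ≡ + n
sum-replicate-1 zero    = refl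
sum-replicate-1 (suc n) = cong (ℤ._+_ 1ℤ) (sum-replicate-1 n)

sum-++ : ∀ {m n} (f : Vector ℤ m) (g : Vector ℤ n) → sum (f ++ g) ≡ sum f ℤ.+ sum g
sum-++ {zero}  f g = sym (ℤ.+-identityˡ _)
sum-++ {suc m} f g = trans
  (cong (ℤ._+_ (f zero)) (trans (sum-cong-≗ (++-tail f g)) (sum-++ (f ∘ suc) g)))
  (sym (ℤ.+-assoc (f zero) _ _))
  where
  ++-tail : ∀ {m n} (f : Vector ℤ (suc m)) (g : Vector ℤ n) i → (f ++ g) (suc i) ≡ ((f ∘ suc) ++ g) i
  ++-tail {m} f g i with splitAt m i
  ... | inj₁ _ = refl
  ... | inj₂ _ = refl

-- Induction over the rows of two stacked blocks: facts about such rows are proved for each block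
-- separately.
↑-elim : ∀ m {n} (P : Fin (m + n) → Set) → (∀ i → P (i ↑ˡ n)) → (∀ j → P (m ↑ʳ j)) → ∀ i → P i
↑-elim m {n} P l r i with splitAt m i | Fin.join-splitAt m n i
... | inj₁ j | refl = l j
... | inj₂ j | refl = r j

-- Rationals slightly above √n.

isqrt : ∀ N → ∃ λ r → r * r ≤ N × N < suc r * suc r
isqrt zero = 0 , z≤n , s≤s z≤n
isqrt (suc N) with isqrt N
... | r , r²≤N , N<[1+r]² with suc N ℕ.<? suc r * suc r
...   | yes lt = r , ℕ.m≤n⇒m≤1+n r²≤N , lt
...   | no ¬lt = suc r , ℕ.≮⇒≥ ¬lt ,
  ℕ.≤-<-trans N<[1+r]² (ℕ.*-mono-< (ℕ.n<1+n (suc r)) (ℕ.n<1+n (suc r)))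

-- With denominator d = 2n + 1 the mesh 1/d is fine enough that the first multiple of 1/d above
-- √n has its square at most n + 1.
rational-square-between : ∀ n → let d = suc (2 * n) in
  ∃ λ r → n * (d * d) < suc r * suc r × suc r * suc r ≤ suc n * (d * d)
rational-square-between n with isqrt (n * (suc (2 * n) * suc (2 * n)))
... | r , r²≤N , N<[1+r]² = r , N<[1+r]² , (begin
  suc r * suc r                    ≡⟨ [1+r]² r ⟩
  r * r + suc (2 * r)              ≤⟨ ℕ.+-mono-≤ r²≤N (s≤s (ℕ.*-monoʳ-≤ 2 r≤nd)) ⟩
  n * (d * d) + suc (2 * (n * d))  ≤⟨ ℕ.+-monoʳ-≤ (n * (d * d)) 2nd<d² ⟩
  n * (d * d) + d * d              ≡⟨ ℕ.+-comm (n * (d * d)) (d * d) ⟩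
  suc n * (d * d)                  ∎)
  where
  open ℕ.≤-Reasoning
  [1+r]² : ∀ r → suc r * suc r ≡ r * r + suc (2 * r)
  [1+r]² = ℕ.solve-∀
  d = suc (2 * n)
  2nd<d² : 2 * (n * d) < d * d
  2nd<d² = ℕ.≤-trans (ℕ.m≤m+n _ (2 * n)) (ℕ.≤-reflexive (expansion n))
    where
    expansion : ∀ n → suc (2 * (n * suc (2 * n))) + 2 * n ≡ suc (2 * n) * suc (2 * n)
    expansion = ℕ.solve-∀
  r≤nd : r ≤ n * d
  r≤nd = ℕ.≮⇒≥ λ nd<r → contradiction r²≤N (ℕ.<⇒≱ (begin-strict
    n * (d * d)        ≤⟨ scale n ⟩
    (n * d) * (n * d)  <⟨ ℕ.*-mono-< nd<r nd<r ⟩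
    r * r ∎))
    where
    scale : ∀ m → m * (d * d) ≤ (m * d) * (m * d)
    scale zero = z≤n
    scale m@(suc _) = ℕ.≤-trans (ℕ.*-monoˡ-≤ (d * d) (ℕ.m≤m*n m m))
      (ℕ.≤-reflexive (ℕ.[m*n]*[o*p]≡[m*o]*[n*p] m m d d))

ℤ→ℚ-≃ : ∀ z → toℚᵘ (ℤ→ℚ z) ℚᵘ.≃ mkℚᵘ z 0
ℤ→ℚ-≃ z = ℚ.toℚᵘ-fromℚᵘ (mkℚᵘ z 0)

ℤ→ℚ-mono-≤ : ∀ {a b} → a ℤ.≤ b → ℤ→ℚ a ℚ.≤ ℤ→ℚ b
ℤ→ℚ-mono-≤ {a} {b} a≤b = ℚ.toℚᵘ-cancel-≤ (begin
  toℚᵘ (ℤ→ℚ a) ≃⟨ ℤ→ℚ-≃ a ⟩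
  mkℚᵘ a 0     ≤⟨ ℚᵘ.*≤* (ℤ.*-monoʳ-≤-nonNeg 1ℤ a≤b) ⟩
  mkℚᵘ b 0     ≃⟨ ℤ→ℚ-≃ b ⟨
  toℚᵘ (ℤ→ℚ b) ∎)
  where open ℚᵘ.≤-Reasoning

module _ (p d-1 : ℕ) where
  private
    d  = suc d-1
    qᵘ = mkℚᵘ (+ p) d-1
    q  = fromℚᵘ qᵘ

  -- `q` is normalised, so its numerator and denominator may differ from `p` and `d`. Comparisons
  -- with q² therefore pass to the unnormalised fraction p / d, where they become
  -- cross-multiplication.
  square-≃ : toℚᵘ (q ℚ.* q) ℚᵘ.≃ qᵘ ℚᵘ.* qᵘ
  square-≃ = ℚᵘ.≃-trans (ℚ.toℚᵘ-homo-* q q)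
    (ℚᵘ.*-cong {toℚᵘ q} {qᵘ} {toℚᵘ q} {qᵘ} (ℚ.toℚᵘ-fromℚᵘ qᵘ) (ℚ.toℚᵘ-fromℚᵘ qᵘ))

  <-square⁺ : ∀ a → a ℤ.* + (d * d) ℤ.< + (p * p) → ℤ→ℚ a ℚ.< q ℚ.* q
  <-square⁺ a lt = ℚ.toℚᵘ-cancel-< (begin-strict
    toℚᵘ (ℤ→ℚ a)   ≃⟨ ℤ→ℚ-≃ a ⟩
    mkℚᵘ a 0       <⟨ ℚᵘ.*<* (subst (a ℤ.* + (d * d) ℤ.<_)
                        (trans (ℤ.pos-* p p) (sym (ℤ.*-identityʳ _))) lt) ⟩
    qᵘ ℚᵘ.* qᵘ     ≃⟨ square-≃ ⟨
    toℚᵘ (q ℚ.* q) ∎)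
    where open ℚᵘ.≤-Reasoning

  <-square⁻ : ∀ a → ℤ→ℚ a ℚ.< q ℚ.* q → a ℤ.* + (d * d) ℤ.< + (p * p)
  <-square⁻ a lt with ℚᵘ.<-respˡ-≃ (ℤ→ℚ-≃ a) (ℚᵘ.<-respʳ-≃ square-≃ (ℚ.toℚᵘ-mono-< lt))
  ... | ℚᵘ.*<* lt′ = subst (a ℤ.* + (d * d) ℤ.<_)
    (trans (ℤ.*-identityʳ _) (sym (ℤ.pos-* p p))) lt′

-- A bound by √n in the sense of `≤ᵘ` speaks only of rationals q above √n, and the lattice vector it
-- yields depends on q. Squared distances are integers, so one q with n < q² ≤ n + 1 is enough: an
-- integer below q² is below n + 1.
separating-rational : ∀ n → ∃ λ q →
  √ (ℤ→ℚ (+ n)) q × (∀ a → ℤ→ℚ a ℚ.< q ℚ.* q → a ℤ.≤ + n)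
separating-rational n with rational-square-between n
... | r , lo , hi = q , (0<q , <-square⁺ (suc r) (2 * n) (+ n) lo′) , λ a lt →
  subst (a ℤ.≤_) (ℤ.pred-suc (+ n)) (ℤ.i<j⇒i≤pred[j] (ℤ.*-cancelʳ-<-nonNeg {a} {+ suc n} (+ (d * d))
    (ℤ.<-≤-trans (<-square⁻ (suc r) (2 * n) a lt) hi′)))
  where
  d = suc (2 * n)
  q = fromℚᵘ (mkℚᵘ (+ suc r) (2 * n))
  0<q : 0ℚ ℚ.< q
  0<q = ℚ.toℚᵘ-cancel-< (ℚᵘ.<-respʳ-≃ (ℚᵘ.≃-sym (ℚ.toℚᵘ-fromℚᵘ (mkℚᵘ (+ suc r) (2 * n))))
    (ℚᵘ.*<* (ℤ.+<+ (s≤s z≤n))))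
  lo′ : + n ℤ.* + (d * d) ℤ.< + (suc r * suc r)
  lo′ = subst (ℤ._< + (suc r * suc r)) (ℤ.pos-* n (d * d)) (ℤ.+<+ lo)
  hi′ : + (suc r * suc r) ℤ.≤ + suc n ℤ.* + (d * d)
  hi′ = subst (+ (suc r * suc r) ℤ.≤_) (ℤ.pos-* (suc n) (d * d)) (ℤ.+≤+ hi)

-- Distance to a lattice as an inequality between integers.

∥_∥² : ∀ {m} → Vector ℤ m → ℤ
∥ v ∥² = sum λ i → v i ℤ.* v i

residual : ∀ {m n} → Matrix m n → Vector ℤ m → Vector ℤ n → Vector ℤ m
residual B b x i = b i ℤ.- (B · x) i

-- Forward, the infimum is tested at the separating rational only. Backward, the same x witnesses
-- the infimum at every q above √N.
dist≤√⇔ : ∀ {m n} (B : Matrix m n) (b : Vector ℤ m) N →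
  distToSet b (L B) ≤ᵘ √ (ℤ→ℚ (+ N)) ⇔ (∃ λ x → ∥ residual B b x ∥² ℤ.≤ + N)
dist≤√⇔ B b N = mk⇔ to from
  where
  to : distToSet b (L B) ≤ᵘ √ (ℤ→ℚ (+ N)) → ∃ λ x → ∥ residual B b x ∥² ℤ.≤ + N
  to d≤ with separating-rational N
  ... | q , √N<q , bound with d≤ q √N<q
  ...   | v , (x , v≡Bx) , _ , lt = x , subst (ℤ._≤ + N)
    (sum-cong-≗ λ i → cong (λ w → (b i ℤ.- w) ℤ.* (b i ℤ.- w)) (v≡Bx i)) (bound _ lt)
  from : (∃ λ x → ∥ residual B b x ∥² ℤ.≤ + N) → distToSet b (L B) ≤ᵘ √ (ℤ→ℚ (+ N))
  from (x , le) q (0<q , N<q²) =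
    B · x , (x , λ _ → refl) , 0<q , ℚ.≤-<-trans (ℤ→ℚ-mono-≤ le) N<q²

-- Rank and independent columns.

-- If two distinct positions picked the same column, the coefficients 1 and -1 at these positions
-- would give a nontrivial vanishing combination.
independent⇒injective : ∀ {m n s} (B : Matrix m n) (c : Fin s → Fin n) →
  ColumnsIndependent B c → ∀ {p p′} → c p ≡ c p′ → p ≡ p′
independent⇒injective B c ind {p} {p′} cp≡cp′ with p Fin.≟ p′
... | yes p≡p′ = p≡p′
... | no  p≢p′ = contradiction (trans (sym qₚ≡1) (ind q Bq≡0 p)) λ ()
  where
  e  = spike 0ℚ 1ℚ p
  e′ = spike 0ℚ (ℚ.- 1ℚ) p′
  q : Vector ℚ _
  q j = e j ℚ.+ e′ j
  qₚ≡1 : q p ≡ 1ℚ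
  qₚ≡1 = cong₂ ℚ._+_ (spike-at 0ℚ 1ℚ p) (spike-off 0ℚ (ℚ.- 1ℚ) p≢p′)
  Bq≡0 : ∀ i → Sumℚ.sum (λ j → ℤ→ℚ (B i (c j)) ℚ.* q j) ≡ 0ℚ
  Bq≡0 i = begin
    Sumℚ.sum (λ j → w j ℚ.* q j)
      ≡⟨ Sumℚ.sum-cong-≗ (λ j → ℚ.*-distribˡ-+ (w j) (e j) (e′ j)) ⟩
    Sumℚ.sum (λ j → w j ℚ.* e j ℚ.+ w j ℚ.* e′ j)
      ≡⟨ Sumℚ.∑-distrib-+ (λ j → w j ℚ.* e j) (λ j → w j ℚ.* e′ j) ⟩
    Sumℚ.sum (λ j → w j ℚ.* e j) ℚ.+ Sumℚ.sum (λ j → w j ℚ.* e′ j)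
      ≡⟨ cong₂ ℚ._+_ (sumℚ-*-spike 1ℚ p w) (sumℚ-*-spike (ℚ.- 1ℚ) p′ w) ⟩
    w p ℚ.* 1ℚ ℚ.+ w p′ ℚ.* ℚ.- 1ℚ
      ≡⟨ cong (λ l → w p ℚ.* 1ℚ ℚ.+ ℤ→ℚ (B i l) ℚ.* ℚ.- 1ℚ) cp≡cp′ ⟨
    w p ℚ.* 1ℚ ℚ.+ w p ℚ.* ℚ.- 1ℚ
      ≡⟨ ℚ.*-distribˡ-+ (w p) 1ℚ (ℚ.- 1ℚ) ⟨
    w p ℚ.* 0ℚ
      ≡⟨ ℚ.*-zeroʳ (w p) ⟩
    0ℚ ∎
    where
    open ≡-Reasoning
    w : Vector ℚ _
    w j = ℤ→ℚ (B i (c j))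

-- The upper bound on the rank is the pigeonhole principle, applied to the injective choice of
-- columns.
independent⇒fullRank : ∀ {m n} (B : Matrix m n) → ColumnsIndependent B id → HasRank B n
independent⇒fullRank B ind = (id , ind) , λ s c ind′ →
  Fin.injective⇒≤ {f = c} (independent⇒injective B c ind′)

-- The block 2I stacked on an arbitrary matrix.

module _ {n t} (A : Matrix t n) (β : Vector ℤ t) where
  private
    twice : Matrix n n
    twice i = spike 0ℤ (+ 2) i

  stack : Matrix (n + t) n
  stack = twice ++ A

  target : Vector ℤ (n + t)
  target = replicate n 1ℤ ++ β

  -- Row i of the block 2I reads 2 qᵢ = 0, and multiplication by ½ isolates qᵢ.
  stack-independent : ColumnsIndependent stack id
  stack-independent q Bq≡0 i = begin
    q i
      ≡⟨ ℚ.*-identityˡ (q i) ⟨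
    (½ ℚ.* ℤ→ℚ (+ 2)) ℚ.* q i
      ≡⟨ ℚ.*-assoc ½ (ℤ→ℚ (+ 2)) (q i) ⟩
    ½ ℚ.* (ℤ→ℚ (+ 2) ℚ.* q i)
      ≡⟨ cong (λ a → ½ ℚ.* (ℤ→ℚ a ℚ.* q i)) (spike-at 0ℤ (+ 2) i) ⟨
    ½ ℚ.* (ℤ→ℚ (twice i i) ℚ.* q i)
      ≡⟨ cong (½ ℚ.*_) (sum-supported-at ℚ.+-0-commutativeMonoid i _ off) ⟨
    ½ ℚ.* Sumℚ.sum (λ j → ℤ→ℚ (twice i j) ℚ.* q j)
      ≡⟨ cong (λ r → ½ ℚ.* Sumℚ.sum (λ j → ℤ→ℚ (r j) ℚ.* q j)) (lookup-++ˡ twice A i) ⟨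
    ½ ℚ.* Sumℚ.sum (λ j → ℤ→ℚ (stack (i ↑ˡ t) j) ℚ.* q j)
      ≡⟨ cong (½ ℚ.*_) (Bq≡0 (i ↑ˡ t)) ⟩
    0ℚ ∎
    where
    open ≡-Reasoning
    off : ∀ j → j ≢ i → ℤ→ℚ (twice i j) ℚ.* q j ≡ 0ℚ
    off j j≢i = trans (cong (λ a → ℤ→ℚ a ℚ.* q j) (spike-off 0ℤ (+ 2) j≢i)) (ℚ.*-zeroˡ (q j))

  stack-bounded : (∀ c j → ∣ A c j ∣ ≤ 2) → ∀ i j → ∣ stack i j ∣ ≤ 2
  stack-bounded A≤2 = ↑-elim n (λ i → ∀ j → ∣ stack i j ∣ ≤ 2)
    (λ i j → subst (λ r → ∣ r j ∣ ≤ 2) (sym (lookup-++ˡ twice A i)) (twice≤2 i j))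
    (λ c j → subst (λ r → ∣ r j ∣ ≤ 2) (sym (lookup-++ʳ twice A c)) (A≤2 c j))
    where
    twice≤2 : ∀ i j → ∣ twice i j ∣ ≤ 2
    twice≤2 i j with j Fin.≟ i
    ... | yes refl = ℕ.≤-reflexive (cong ∣_∣ (spike-at 0ℤ (+ 2) i))
    ... | no  j≢i  = ℕ.≤-trans (ℕ.≤-reflexive (cong ∣_∣ (spike-off 0ℤ (+ 2) j≢i))) z≤n

  target-bounded : (∀ c → ∣ β c ∣ ≤ 2) → ∀ i → ∣ target i ∣ ≤ 2
  target-bounded β≤2 = ↑-elim n (λ i → ∣ target i ∣ ≤ 2)
    (λ i → subst (λ a → ∣ a ∣ ≤ 2) (sym (lookup-++ˡ (replicate n 1ℤ) β i)) (s≤s z≤n))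
    (λ c → subst (λ a → ∣ a ∣ ≤ 2) (sym (lookup-++ʳ (replicate n 1ℤ) β c)) (β≤2 c))

  residual-↑ˡ : ∀ x i → residual stack target x (i ↑ˡ t) ≡ 1ℤ ℤ.- + 2 ℤ.* x i
  residual-↑ˡ x i = cong₂ ℤ._-_ (lookup-++ˡ (replicate n 1ℤ) β i)
    (trans (cong (λ r → sum λ j → r j ℤ.* x j) (lookup-++ˡ twice A i)) (sum-spike-* (+ 2) i x))

  residual-↑ʳ : ∀ x c → residual stack target x (n ↑ʳ c) ≡ β c ℤ.- (A · x) c
  residual-↑ʳ x c = cong₂ ℤ._-_ (lookup-++ʳ (replicate n 1ℤ) β c)
    (cong (λ r → sum λ j → r j ℤ.* x j) (lookup-++ʳ twice A c))

-- Tight residuals and 0/1 solutions.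

-- A lower bound for each squared residual: 1 in the rows of 2I, 0 in the rows of A. Its total is
-- exactly the squared distance allowed.
floor : ∀ n t → Vector ℤ (n + t)
floor n t = replicate n 1ℤ ++ replicate t 0ℤ

sum-floor : ∀ n t → sum (floor n t) ≡ + n
sum-floor n t = trans (sum-++ (replicate n 1ℤ) (replicate t 0ℤ))
  (trans (cong₂ ℤ._+_ (sum-replicate-1 n) (sum-replicate-zero t)) (ℤ.+-identityʳ (+ n)))

0≤i*i : ∀ i → 0ℤ ℤ.≤ i ℤ.* i
0≤i*i (+ zero)  = ℤ.≤-refl
0≤i*i (+ suc _) = ℤ.+≤+ z≤n
0≤i*i -[1+ _ ]  = ℤ.+≤+ z≤n

-- No integer lies strictly between 0 and 1. This is where the integrality of lattice coefficients
-- enters; the inequality fails for i = ½.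
0≤i*[i-1] : ∀ i → 0ℤ ℤ.≤ i ℤ.* (i ℤ.- 1ℤ)
0≤i*[i-1] (+ zero)        = ℤ.≤-refl
0≤i*[i-1] (+ suc zero)    = ℤ.≤-refl
0≤i*[i-1] (+ suc (suc _)) = ℤ.+≤+ z≤n
0≤i*[i-1] -[1+ _ ]        = ℤ.+≤+ z≤n

[1-2i]² : ∀ i → (1ℤ ℤ.- + 2 ℤ.* i) ℤ.* (1ℤ ℤ.- + 2 ℤ.* i) ≡ 1ℤ ℤ.+ + 4 ℤ.* (i ℤ.* (i ℤ.- 1ℤ))
[1-2i]² = ℤ.solve-∀

bit : Bool → ℕ
bit b = if b then 1 else 0

bits : ∀ {n} → Vec Bool n → Vector ℤ n
bits y j = + bit (lookup y j)

-- The bit is given by a decision on i, so that a Boolean vector can be tabulated directly from an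
-- integer solution.
i*[i-1]≡0⇒bit : ∀ i → i ℤ.* (i ℤ.- 1ℤ) ≡ 0ℤ → i ≡ + bit (does (i ℤ.≟ 1ℤ))
i*[i-1]≡0⇒bit i eq with ℤ.i*j≡0⇒i≡0∨j≡0 i eq
... | inj₁ refl = refl
... | inj₂ i-1≡0 with refl ← ℤ.i-j≡0⇒i≡j i 1ℤ i-1≡0 = refl

[1-2bit]²≡1 : ∀ b → (1ℤ ℤ.- + 2 ℤ.* + bit b) ℤ.* (1ℤ ℤ.- + 2 ℤ.* + bit b) ≡ 1ℤ
[1-2bit]²≡1 true  = refl
[1-2bit]²≡1 false = refl

1≤[1-2i]² : ∀ i → 1ℤ ℤ.≤ (1ℤ ℤ.- + 2 ℤ.* i) ℤ.* (1ℤ ℤ.- + 2 ℤ.* i)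
1≤[1-2i]² i = subst (1ℤ ℤ.≤_) (sym ([1-2i]² i))
  (ℤ.+-monoʳ-≤ 1ℤ (ℤ.*-monoˡ-≤-nonNeg (+ 4) (0≤i*[i-1] i)))

[1-2i]²≡1⇒bit : ∀ i → 1ℤ ≡ (1ℤ ℤ.- + 2 ℤ.* i) ℤ.* (1ℤ ℤ.- + 2 ℤ.* i) → i ≡ + bit (does (i ℤ.≟ 1ℤ))
[1-2i]²≡1⇒bit i eq = i*[i-1]≡0⇒bit i (ℤ.*-cancelˡ-≡ (+ 4) _ 0ℤ
  (∙-cancelˡ 1ℤ _ 0ℤ (trans (sym ([1-2i]² i)) (sym eq))))

module _ {n t} (A : Matrix t n) (β : Vector ℤ t) where
  private
    B = stack A β
    b = target A β

  near⇔binary-solution :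
    (∃ λ x → ∥ residual B b x ∥² ℤ.≤ + n) ⇔ (∃ λ y → ∀ c → (A · bits y) c ≡ β c)
  near⇔binary-solution = mk⇔ to from
    where
    floor-↑ˡ = lookup-++ˡ (replicate n 1ℤ) (replicate t 0ℤ)
    floor-↑ʳ = lookup-++ʳ (replicate n 1ℤ) (replicate t 0ℤ)

    square : Vector ℤ n → Vector ℤ (n + t)
    square x i = residual B b x i ℤ.* residual B b x i

    square-↑ˡ : ∀ x i → square x (i ↑ˡ t) ≡ (1ℤ ℤ.- + 2 ℤ.* x i) ℤ.* (1ℤ ℤ.- + 2 ℤ.* x i)
    square-↑ˡ x i = cong₂ ℤ._*_ (residual-↑ˡ A β x i) (residual-↑ˡ A β x i)

    square-↑ʳ : ∀ x c → square x (n ↑ʳ c) ≡ (β c ℤ.- (A · x) c) ℤ.* (β c ℤ.- (A · x) c)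
    square-↑ʳ x c = cong₂ ℤ._*_ (residual-↑ʳ A β x c) (residual-↑ʳ A β x c)

    floor≤square : ∀ x i → floor n t i ℤ.≤ square x i
    floor≤square x = ↑-elim n (λ i → floor n t i ℤ.≤ square x i)
      (λ i → subst₂ ℤ._≤_ (sym (floor-↑ˡ i)) (sym (square-↑ˡ x i)) (1≤[1-2i]² (x i)))
      (λ c → subst (ℤ._≤ square x (n ↑ʳ c)) (sym (floor-↑ʳ c)) (0≤i*i (residual B b x (n ↑ʳ c))))

    to : (∃ λ x → ∥ residual B b x ∥² ℤ.≤ + n) → ∃ λ y → ∀ c → (A · bits y) c ≡ β c
    to (x , near) = y , λ c → trans (A·bits≡A·x c) (A·x≡β c)
      where
      -- The lower bounds already add up to n, so no row may exceed its own. Tightness in the rows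
      -- of 2I makes x binary; in the rows of A it makes the squared residual 0.
      tight : ∀ i → floor n t i ≡ square x i
      tight = sum-tight (floor≤square x) (subst (∥ residual B b x ∥² ℤ.≤_) (sym (sum-floor n t)) near)
      y = tabulate λ j → does (x j ℤ.≟ 1ℤ)
      x≡bits : ∀ j → x j ≡ bits y j
      x≡bits j = trans
        ([1-2i]²≡1⇒bit (x j) (trans (sym (floor-↑ˡ j)) (trans (tight (j ↑ˡ t)) (square-↑ˡ x j))))
        (cong (+_ ∘ bit) (sym (lookup∘tabulate _ j)))
      A·bits≡A·x : ∀ c → (A · bits y) c ≡ (A · x) c
      A·bits≡A·x c = sum-cong-≗ λ j → cong (A c j ℤ.*_) (sym (x≡bits j))
      A·x≡β : ∀ c → (A · x) c ≡ β c
      A·x≡β c = sym (ℤ.i-j≡0⇒i≡j (β c) _ ([ id , id ]′ (ℤ.i*j≡0⇒i≡0∨j≡0 (β c ℤ.- (A · x) c)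
        (trans (sym (square-↑ʳ x c)) (trans (sym (tight (n ↑ʳ c))) (floor-↑ʳ c))))))

    from : (∃ λ y → ∀ c → (A · bits y) c ≡ β c) → ∃ λ x → ∥ residual B b x ∥² ℤ.≤ + n
    from (y , A·y≡β) = bits y , ℤ.≤-reflexive (trans (sum-cong-≗ square≡floor) (sum-floor n t))
      where
      square≡floor : ∀ i → square (bits y) i ≡ floor n t i
      square≡floor = ↑-elim n (λ i → square (bits y) i ≡ floor n t i)
        (λ i → trans (square-↑ˡ (bits y) i) (trans ([1-2bit]²≡1 (lookup y i)) (sym (floor-↑ˡ i))))
        (λ c → trans (square-↑ʳ (bits y) c)
          (trans (cong (λ a → a ℤ.* a) (ℤ.i≡j⇒i-j≡0 (sym (A·y≡β c)))) (sym (floor-↑ʳ c))))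

-- Literals and counting.

pos-injective : ∀ {k} {i j : Fin k} → pos i ≡ pos j → i ≡ j
pos-injective refl = refl

neg-injective : ∀ {k} {i j : Fin k} → neg i ≡ neg j → i ≡ j
neg-injective refl = refl

_≟ᴸ_ : ∀ {k} → DecidableEquality (Literal k)
pos i ≟ᴸ pos j = Dec.map′ (cong pos) pos-injective (i Fin.≟ j)
pos i ≟ᴸ neg j = no λ ()
neg i ≟ᴸ pos j = no λ ()
neg i ≟ᴸ neg j = Dec.map′ (cong neg) neg-injective (i Fin.≟ j)

isNeg : ∀ {k} → Literal k → Bool
isNeg (pos _) = false
isNeg (neg _) = true

count : ∀ {A : Set} → (A → Bool) → List A → ℕ
count p []       = 0
count p (x ∷ xs) = bit (p x) + count p xs

count-map : ∀ {A B : Set} (p : B → Bool) (f : A → B) xs → count p (List.map f xs) ≡ count (p ∘ f) xs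
count-map p f []       = refl
count-map p f (x ∷ xs) = cong (_+_ (bit (p (f x)))) (count-map p f xs)

count-cong : ∀ {A : Set} {p q : A → Bool} → (∀ x → p x ≡ q x) → ∀ xs → count p xs ≡ count q xs
count-cong p≗q []       = refl
count-cong p≗q (x ∷ xs) = cong₂ (λ b m → bit b + m) (p≗q x) (count-cong p≗q xs)

count-++ : ∀ {A : Set} (p : A → Bool) xs ys → count p (xs List.++ ys) ≡ count p xs + count p ys
count-++ p []       ys = refl
count-++ p (x ∷ xs) ys = trans (cong (_+_ (bit (p x))) (count-++ p xs ys)) (sym (ℕ.+-assoc (bit (p x)) _ _))

bit≤1 : ∀ b → bit b ≤ 1
bit≤1 true  = ℕ.≤-refl
bit≤1 false = z≤n

count≤length : ∀ {A : Set} (p : A → Bool) xs → count p xs ≤ length xs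
count≤length p []       = z≤n
count≤length p (x ∷ xs) = ℕ.+-mono-≤ (bit≤1 (p x)) (count≤length p xs)

0<count⇒Any : ∀ {A : Set} (p : A → Bool) xs → 0 < count p xs → Any (λ x → p x ≡ true) xs
0<count⇒Any p (x ∷ xs) 0<c with p x in eq
... | true  = here eq
... | false = there (0<count⇒Any p xs 0<c)

Any⇒0<count : ∀ {A : Set} (p : A → Bool) {xs} → Any (λ x → p x ≡ true) xs → 0 < count p xs
Any⇒0<count p (here px≡true) rewrite px≡true = s≤s z≤n
Any⇒0<count p (there {x} any) = ℕ.≤-trans (Any⇒0<count p any) (ℕ.m≤n+m _ (bit (p x)))

-- The number of true literals as an affine form.

literalCoeff : ∀ {n} → Literal n → Vector ℤ n
literalCoeff (pos i) = spike 0ℤ 1ℤ i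
literalCoeff (neg i) = spike 0ℤ -1ℤ i

coeff : ∀ {n} → List (Literal n) → Vector ℤ n
coeff []       j = 0ℤ
coeff (l ∷ ls) j = literalCoeff l j ℤ.+ coeff ls j

literal-sum : ∀ {n} (y : Vec Bool n) l →
  sum (λ j → literalCoeff l j ℤ.* bits y j) ℤ.+ + bit (isNeg l) ≡ + bit (evalLiteral y l)
literal-sum y (pos i) = trans (ℤ.+-identityʳ _) (trans (sum-spike-* 1ℤ i (bits y)) (ℤ.*-identityˡ _))
literal-sum y (neg i) = trans (cong (ℤ._+ 1ℤ) (sum-spike-* -1ℤ i (bits y))) (complement (lookup y i))
  where
  complement : ∀ b → -1ℤ ℤ.* + bit b ℤ.+ 1ℤ ≡ + bit (not b)
  complement true  = refl
  complement false = refl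

-- A negated variable contributes 1 - x, so the number of true literals is affine in the variables,
-- with constant term the number of negated literals.
coeff-sum : ∀ {n} (y : Vec Bool n) ls →
  sum (λ j → coeff ls j ℤ.* bits y j) ℤ.+ + count isNeg ls ≡ + count (evalLiteral y) ls
coeff-sum {n} y [] = trans (ℤ.+-identityʳ _)
  (trans (sum-cong-≗ λ j → ℤ.*-zeroˡ (bits y j)) (sum-replicate-zero n))
coeff-sum y (l ∷ ls) = begin
  sum (λ j → (literalCoeff l j ℤ.+ coeff ls j) ℤ.* bits y j) ℤ.+ (+ ν ℤ.+ + νs)
    ≡⟨ cong (ℤ._+ (+ ν ℤ.+ + νs)) (trans
         (sum-cong-≗ λ j → ℤ.*-distribʳ-+ (bits y j) (literalCoeff l j) (coeff ls j))
         (∑-distrib-+ (λ j → literalCoeff l j ℤ.* bits y j) (λ j → coeff ls j ℤ.* bits y j))) ⟩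
  (S ℤ.+ Ss) ℤ.+ (+ ν ℤ.+ + νs)
    ≡⟨ interchange S Ss (+ ν) (+ νs) ⟩
  (S ℤ.+ + ν) ℤ.+ (Ss ℤ.+ + νs)
    ≡⟨ cong₂ ℤ._+_ (literal-sum y l) (coeff-sum y ls) ⟩
  + count (evalLiteral y) (l ∷ ls) ∎
  where
  open ≡-Reasoning
  ν  = bit (isNeg l)
  νs = count isNeg ls
  S  = sum λ j → literalCoeff l j ℤ.* bits y j
  Ss = sum λ j → coeff ls j ℤ.* bits y j
  interchange : ∀ a b c d → (a ℤ.+ b) ℤ.+ (c ℤ.+ d) ≡ (a ℤ.+ c) ℤ.+ (b ℤ.+ d)
  interchange = ℤ.solve-∀

coeff-++ : ∀ {n} (ls ls′ : List (Literal n)) j → coeff (ls List.++ ls′) j ≡ coeff ls j ℤ.+ coeff ls′ j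
coeff-++ []       ls′ j = sym (ℤ.+-identityˡ _)
coeff-++ (l ∷ ls) ls′ j = trans (cong (ℤ._+_ (literalCoeff l j)) (coeff-++ ls ls′ j))
  (sym (ℤ.+-assoc (literalCoeff l j) _ _))

occurrences : ∀ {n} → Literal n → List (Literal n) → ℕ
occurrences l = count λ l′ → does (l ≟ᴸ l′)

literalCoeff-occurrences : ∀ {n} (l : Literal n) j →
  literalCoeff l j ≡ + occurrences (pos j) (l ∷ []) ℤ.- + occurrences (neg j) (l ∷ [])
literalCoeff-occurrences (pos i) j with j Fin.≟ i
... | yes refl = spike-at 0ℤ 1ℤ i
... | no  j≢i  = spike-off 0ℤ 1ℤ j≢i
literalCoeff-occurrences (neg i) j with j Fin.≟ i
... | yes refl = spike-at 0ℤ -1ℤ i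
... | no  j≢i  = spike-off 0ℤ -1ℤ j≢i

-- Opposite literals of one variable cancel, so a coefficient is a signed count. This reduces bounds
-- on matrix entries to bounds on multiplicities.
coeff-occurrences : ∀ {n} (ls : List (Literal n)) j →
  coeff ls j ≡ + occurrences (pos j) ls ℤ.- + occurrences (neg j) ls
coeff-occurrences []       j = refl
coeff-occurrences (l ∷ ls) j = trans
  (cong₂ ℤ._+_ (literalCoeff-occurrences l j) (coeff-occurrences ls j))
  -- Occurrences in a one-element list unfold to `p + 0` and `q + 0`; the zeros are removed
  -- afterwards.
  (trans (interchange (+ (p + 0)) (+ (q + 0)) (+ ps) (+ qs))
    (cong₂ (λ a b → + (a + ps) ℤ.- + (b + qs)) (ℕ.+-identityʳ p) (ℕ.+-identityʳ q)))
  where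
  p  = bit (does (pos j ≟ᴸ l))
  q  = bit (does (neg j ≟ᴸ l))
  ps = occurrences (pos j) ls
  qs = occurrences (neg j) ls
  interchange : ∀ a b c d → (a ℤ.+ ℤ.- b) ℤ.+ (c ℤ.+ ℤ.- d) ≡ (a ℤ.+ c) ℤ.+ ℤ.- (b ℤ.+ d)
  interchange = ℤ.solve-∀

occurrences-fresh : ∀ {n} (l : Literal n) {ls} → All (l ≢_) ls → occurrences l ls ≡ 0
occurrences-fresh l [] = refl
occurrences-fresh l {l′ ∷ _} (l≢l′ ∷ l∉ls) with l ≟ᴸ l′
... | yes l≡l′ = contradiction l≡l′ l≢l′
... | no  _    = occurrences-fresh l l∉ls

occurrences-unique : ∀ {n} (l : Literal n) {ls} → Unique ls → occurrences l ls ≤ 1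
occurrences-unique l [] = z≤n
occurrences-unique l {l′ ∷ _} (l′∉ls ∷ uls) with l ≟ᴸ l′
... | yes refl = s≤s (ℕ.≤-reflexive (occurrences-fresh l l′∉ls))
... | no  _    = occurrences-unique l uls

-- The difference of two naturals is at most their maximum in absolute value. The triangle
-- inequality would give only 2 here.
∣coeff∣≤1 : ∀ {n} {ls : List (Literal n)} → Unique ls → ∀ j → ∣ coeff ls j ∣ ≤ 1
∣coeff∣≤1 {ls = ls} uls j = begin
  ∣ coeff ls j ∣  ≡⟨ cong ∣_∣ (trans (coeff-occurrences ls j) (ℤ.m-n≡m⊖n p q)) ⟩
  ∣ p ⊖ q ∣       ≤⟨ ℤ.∣m⊝n∣≤m⊔n p q ⟩
  p ℕ.⊔ q         ≤⟨ ℕ.⊔-lub (occurrences-unique (pos j) uls) (occurrences-unique (neg j) uls) ⟩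
  1               ∎
  where
  open ℕ.≤-Reasoning
  p = occurrences (pos j) ls
  q = occurrences (neg j) ls

-- Truth of clauses and formulas.

evalClause⇔Any : ∀ {k} (a : Assignment k) c →
  evalClause a c ≡ true ⇔ Any (λ l → evalLiteral a l ≡ true) (toList (literals c))
evalClause⇔Any a c = mk⇔ (to (literals c)) (from (literals c))
  where
  to : ∀ {w} (ls : Vec _ w) → Vec.foldr′ _∨_ false (Vec.map (evalLiteral a) ls) ≡ true →
       Any (λ l → evalLiteral a l ≡ true) (toList ls)
  to (l ∷ ls) eq with evalLiteral a l in eqₗ
  ... | true  = here eqₗ
  ... | false = there (to ls eq)
  from : ∀ {w} (ls : Vec _ w) → Any (λ l → evalLiteral a l ≡ true) (toList ls) →
         Vec.foldr′ _∨_ false (Vec.map (evalLiteral a) ls) ≡ true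
  from (l ∷ ls) (here eq) rewrite eq = refl
  from (l ∷ ls) (there any) with evalLiteral a l
  ... | true  = refl
  ... | false = from ls any

evalFormula⇔∀ : ∀ {k t} (a : Assignment k) (φ : Formula k t) →
  evalFormula a φ ≡ true ⇔ (∀ c → evalClause a (lookup φ c) ≡ true)
evalFormula⇔∀ a φ = mk⇔ (to φ) (from φ)
  where
  to : ∀ {t} (φ : Formula _ t) → evalFormula a φ ≡ true → ∀ c → evalClause a (lookup φ c) ≡ true
  to (ψ ∷ φ) eq c with evalClause a ψ in eqψ
  to (ψ ∷ φ) eq zero    | true = eqψ
  to (ψ ∷ φ) eq (suc c) | true = to φ eq c
  from : ∀ {t} (φ : Formula _ t) → (∀ c → evalClause a (lookup φ c) ≡ true) → evalFormula a φ ≡ true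
  from []      all = refl
  from (ψ ∷ φ) all rewrite all zero = from φ (all ∘ suc)

-- Kept with repetitions, the clause x ∨ x ∨ x would produce the matrix entry 3.
distinctLiterals : ∀ {k} → Clause k → List (Literal k)
distinctLiterals ψ = deduplicate _≟ᴸ_ (toList (literals ψ))

length-distinctLiterals : ∀ {k} (ψ : Clause k) → length (distinctLiterals ψ) ≤ 3
length-distinctLiterals ψ = ℕ.≤-trans (length-deduplicate _≟ᴸ_ (toList (literals ψ)))
  (ℕ.≤-trans (ℕ.≤-reflexive (length-toList (literals ψ))) (width≤3 ψ))

evalClause⇔0<count : ∀ {k} (a : Assignment k) ψ →
  evalClause a ψ ≡ true ⇔ 0 < count (evalLiteral a) (distinctLiterals ψ)
evalClause⇔0<count a ψ = mk⇔
  (λ eq → Any⇒0<count (evalLiteral a)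
    (deduplicate⁺ _≟ᴸ_ (λ l≡l′ → trans (cong (evalLiteral a) l≡l′))
      (Equivalence.to (evalClause⇔Any a ψ) eq)))
  (λ 0<c → Equivalence.from (evalClause⇔Any a ψ)
    (deduplicate⁻ _≟ᴸ_ (0<count⇒Any (evalLiteral a) (distinctLiterals ψ) 0<c)))

-- The linear system of a formula.

module _ {k t} (φ : Formula k t) where
  private
    n = k + 2 * t

  embed : Literal k → Literal n
  embed (pos i) = pos (i ↑ˡ (2 * t))
  embed (neg i) = neg (i ↑ˡ (2 * t))

  embed-injective : ∀ {l l′} → embed l ≡ embed l′ → l ≡ l′
  embed-injective {pos i} {pos j} eq = cong pos (Fin.↑ˡ-injective (2 * t) i j (pos-injective eq))
  embed-injective {neg i} {neg j} eq = cong neg (Fin.↑ˡ-injective (2 * t) i j (neg-injective eq))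

  isNeg-embed : ∀ l → isNeg (embed l) ≡ isNeg l
  isNeg-embed (pos _) = refl
  isNeg-embed (neg _) = refl

  -- The last 2t coordinates are read as a 2 × t array: two slack variables for each clause.
  slack : Fin 2 → Fin t → Fin n
  slack s c = k ↑ʳ combine s c

  -- The slack literals are negated for the sake of the target. With ν ≤ 3 negated own literals it
  -- becomes 3 - (ν + 2) = 1 - ν, between -2 and 1; positive slack literals would give 3 - ν, which
  -- is 3 for a clause without negations.
  ownLiterals slackLiterals rowLiterals : Fin t → List (Literal n)
  ownLiterals c   = List.map embed (distinctLiterals (lookup φ c))
  slackLiterals c = neg (slack zero c) ∷ neg (slack (suc zero) c) ∷ []
  rowLiterals c   = ownLiterals c List.++ slackLiterals c

  slackLiterals-unique : ∀ c → Unique (slackLiterals c)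
  slackLiterals-unique c = (distinct ∷ []) ∷ [] ∷ []
    where
    distinct : neg (slack zero c) ≢ neg (slack (suc zero) c)
    distinct eq with Fin.combine-injectiveˡ {2} {t} zero c (suc zero) c
      (Fin.↑ʳ-injective k _ _ (neg-injective eq))
    ... | ()

  clauseMatrix : Matrix t n
  clauseMatrix c = coeff (rowLiterals c)

  clauseTarget : Vector ℤ t
  clauseTarget c = + 3 ℤ.- + count isNeg (rowLiterals c)

  -- Own and slack literals are each free of repetitions, so each list contributes at most 1 to an
  -- entry.
  clauseMatrix-bounded : ∀ c j → ∣ clauseMatrix c j ∣ ≤ 2
  clauseMatrix-bounded c j = begin
    ∣ coeff (rowLiterals c) j ∣
      ≡⟨ cong ∣_∣ (coeff-++ (ownLiterals c) (slackLiterals c) j) ⟩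
    ∣ coeff (ownLiterals c) j ℤ.+ coeff (slackLiterals c) j ∣
      ≤⟨ ℤ.∣i+j∣≤∣i∣+∣j∣ (coeff (ownLiterals c) j) (coeff (slackLiterals c) j) ⟩
    ∣ coeff (ownLiterals c) j ∣ + ∣ coeff (slackLiterals c) j ∣
      ≤⟨ ℕ.+-mono-≤
           (∣coeff∣≤1 (map⁺ embed-injective (deduplicate-! _≟ᴸ_ (toList (literals (lookup φ c))))) j)
           (∣coeff∣≤1 (slackLiterals-unique c) j) ⟩
    2 ∎
    where open ℕ.≤-Reasoning

  clauseTarget-bounded : ∀ c → ∣ clauseTarget c ∣ ≤ 2
  clauseTarget-bounded c = subst (λ m → ∣ + 3 ℤ.- + m ∣ ≤ 2)
    (sym (count-++ isNeg (ownLiterals c) (slackLiterals c))) (bound _ own≤3)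
    where
    own≤3 : count isNeg (ownLiterals c) ≤ 3
    own≤3 = subst (_≤ 3)
      (sym (trans (count-map isNeg embed ls) (count-cong isNeg-embed ls)))
      (ℕ.≤-trans (count≤length isNeg ls) (length-distinctLiterals (lookup φ c)))
      where ls = distinctLiterals (lookup φ c)
    bound : ∀ m → m ≤ 3 → ∣ + 3 ℤ.- + (m + 2) ∣ ≤ 2
    bound 0 _ = s≤s z≤n
    bound 1 _ = z≤n
    bound 2 _ = s≤s z≤n
    bound 3 _ = s≤s (s≤s z≤n)
    bound (suc (suc (suc (suc _)))) (s≤s (s≤s (s≤s ())))

  -- Adding the number ν of negated literals to both sides turns the left side into the number of
  -- true literals and the right side into 3.
  row⇔threeTrue : ∀ y c →
    (clauseMatrix · bits y) c ≡ clauseTarget c ⇔ count (evalLiteral y) (rowLiterals c) ≡ 3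
  row⇔threeTrue y c = mk⇔
    (λ eq → ℤ.+-injective (begin
      + count (evalLiteral y) (rowLiterals c)  ≡⟨ coeff-sum y (rowLiterals c) ⟨
      (clauseMatrix · bits y) c ℤ.+ ν          ≡⟨ cong (ℤ._+ ν) eq ⟩
      + 3 ℤ.- ν ℤ.+ ν                          ≡⟨ cancel (+ 3) ν ⟩
      + 3                                      ∎))
    (λ eq → ∙-cancelʳ ν _ _ (begin
      (clauseMatrix · bits y) c ℤ.+ ν          ≡⟨ coeff-sum y (rowLiterals c) ⟩
      + count (evalLiteral y) (rowLiterals c)  ≡⟨ cong +_ eq ⟩
      + 3                                      ≡⟨ cancel (+ 3) ν ⟨
      + 3 ℤ.- ν ℤ.+ ν                          ∎))
    where
    open ≡-Reasoning
    ν = + count isNeg (rowLiterals c)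
    cancel : ∀ a b → a ℤ.+ ℤ.- b ℤ.+ b ≡ a
    cancel = ℤ.solve-∀

  module _ (a : Assignment k) (y : Vec Bool n)
           (y-extends-a : ∀ i → lookup y (i ↑ˡ (2 * t)) ≡ lookup a i) where

    -- Stated for any `y` extending `a`, since one direction below builds `y` from `a` and the other
    -- restricts `y` to `a`.
    evalLiteral-embed : ∀ l → evalLiteral y (embed l) ≡ evalLiteral a l
    evalLiteral-embed (pos i) = y-extends-a i
    evalLiteral-embed (neg i) = cong not (y-extends-a i)

    count-rowLiterals : ∀ c → count (evalLiteral y) (rowLiterals c) ≡
      count (evalLiteral a) (distinctLiterals (lookup φ c)) + count (evalLiteral y) (slackLiterals c)
    count-rowLiterals c = trans (count-++ (evalLiteral y) (ownLiterals c) (slackLiterals c))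
      (cong (_+ count (evalLiteral y) (slackLiterals c))
        (trans (count-map (evalLiteral y) embed ls) (count-cong evalLiteral-embed ls)))
      where ls = distinctLiterals (lookup φ c)

  satisfiable⇔binary-solution :
    Satisfiable φ ⇔ (∃ λ y → ∀ c → (clauseMatrix · bits y) c ≡ clauseTarget c)
  satisfiable⇔binary-solution = mk⇔ to from
    where
    to : Satisfiable φ → ∃ λ y → ∀ c → (clauseMatrix · bits y) c ≡ clauseTarget c
    to (a , sat) = y , λ c → Equivalence.from (row⇔threeTrue y c)
      (trans (count-rowLiterals a y y-var c) (trans
        (cong₂ (λ u v → trueCount c + (bit (not u) + (bit (not v) + 0)))
          (y-slack zero c) (y-slack (suc zero) c))
        (fill (trueCount c) (0<trueCount c) (trueCount≤3 c))))
      where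
      trueCount : Fin t → ℕ
      trueCount c = count (evalLiteral a) (distinctLiterals (lookup φ c))
      0<trueCount : ∀ c → 0 < trueCount c
      0<trueCount c = Equivalence.to (evalClause⇔0<count a (lookup φ c))
        (Equivalence.to (evalFormula⇔∀ a φ) sat c)
      trueCount≤3 : ∀ c → trueCount c ≤ 3
      trueCount≤3 c = ℕ.≤-trans (count≤length _ (distinctLiterals (lookup φ c)))
        (length-distinctLiterals (lookup φ c))
      -- With s true own literals, 3 - s of the negated slack literals must be true. The thresholds
      -- 1 and 2 leave two, one or no slack variables false for s = 1, 2, 3.
      slackValue : Fin 2 → Fin t → Bool
      slackValue zero    c = 1 <ᵇ trueCount c
      slackValue (suc _) c = 2 <ᵇ trueCount c
      value : Vector Bool n
      value = lookup a ++ (uncurry slackValue ∘ remQuot {2} t)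
      y = tabulate value
      y-var : ∀ i → lookup y (i ↑ˡ (2 * t)) ≡ lookup a i
      y-var i = trans (lookup∘tabulate value _) (lookup-++ˡ (lookup a) _ i)
      y-slack : ∀ s c → lookup y (slack s c) ≡ slackValue s c
      y-slack s c = trans (lookup∘tabulate value _) (trans (lookup-++ʳ (lookup a) _ (combine s c))
        (cong (uncurry slackValue) (Fin.remQuot-combine s c)))
      fill : ∀ s → 0 < s → s ≤ 3 → s + (bit (not (1 <ᵇ s)) + (bit (not (2 <ᵇ s)) + 0)) ≡ 3
      fill 1 _ _ = refl
      fill 2 _ _ = refl
      fill 3 _ _ = refl
      fill (suc (suc (suc (suc _)))) _ (s≤s (s≤s (s≤s ())))
    from : (∃ λ y → ∀ c → (clauseMatrix · bits y) c ≡ clauseTarget c) → Satisfiable φ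
    from (y , solves) = a , Equivalence.from (evalFormula⇔∀ a φ) λ c →
      -- At most two of the three true literals are slack, so 1 + 2 is at most the number of true
      -- own literals plus 2; cancelling 2 leaves a true own literal.
      Equivalence.from (evalClause⇔0<count a (lookup φ c)) (ℕ.+-cancelʳ-≤ 2 1 _
        (subst (_≤ count (evalLiteral a) (distinctLiterals (lookup φ c)) + 2)
          (trans (sym (count-rowLiterals a y (sym ∘ lookup∘tabulate _) c))
            (Equivalence.to (row⇔threeTrue y c) (solves c)))
          (ℕ.+-monoʳ-≤ _ (count≤length (evalLiteral y) (slackLiterals c)))))
      where
      a = tabulate λ i → lookup y (i ↑ˡ (2 * t))

theorem1 : ∀ (k t : ℕ) (φ : Formula k t) →
    let m = k + 3 * t
        n = k + 2 * t
    in Σ (Matrix m n) λ B → Σ (Vector ℤ m) λ b →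
         HasRank B n ×
         (∀ i j → ∣ B i j ∣ ≤ 2) ×
         (∀ i → ∣ b i ∣ ≤ 2) ×
         (Satisfiable φ ⇔ (distToSet b (L B) ≤ᵘ √ (ℤ→ℚ (+ n))))
-- Stacking yields n + t rows, which agrees with k + 3t only up to a propositional equality, so the
-- whole statement is transported along it.
theorem1 k t φ = subst Reduction (n+t≡k+3t k t)
  ( stack A β , target A β
  , independent⇒fullRank (stack A β) (stack-independent A β)
  , stack-bounded A β (clauseMatrix-bounded φ)
  , target-bounded A β (clauseTarget-bounded φ)
  , (⇔-sym (dist≤√⇔ (stack A β) (target A β) n)
      ⇔-∘ (⇔-sym (near⇔binary-solution A β) ⇔-∘ satisfiable⇔binary-solution φ)))
  where
  n = k + 2 * t
  A = clauseMatrix φ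
  β = clauseTarget φ
  Reduction : ℕ → Set
  Reduction m = Σ (Matrix m n) λ B → Σ (Vector ℤ m) λ b →
    HasRank B n × (∀ i j → ∣ B i j ∣ ≤ 2) × (∀ i → ∣ b i ∣ ≤ 2) ×
    (Satisfiable φ ⇔ (distToSet b (L B) ≤ᵘ √ (ℤ→ℚ (+ n))))
  n+t≡k+3t : ∀ k t → k + 2 * t + t ≡ k + 3 * t
  n+t≡k+3t = ℕ.solve-∀
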